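{- Let $\mathbb K$ be a field of characteristic $p>2$, $V_{\mathbb K}$ a vector space over $\mathbb K$, and let $L_1,\dots,L_n:\mathbb Z^n\to\mathrm{GL}(V_{\mathbb K})$ define a $p$-invariant discrete flat connection on $\mathbb Z^n\times V_{\mathbb K}\to\mathbb Z^n$, with $p$-curvature functions $C_l(k)=L_l(k+(p-1)f_l)\cdots L_l(k+f_l)L_l(k)$. Then for all $1\le l,m\le n$ and $k\in\mathbb Z^n$: $$C_l(k+f_m)L_m(k)=L_m(k)C_l(k),\qquad C_l(k)C_m(k)=C_m(k)C_l(k),\qquad C_l(k+pf_m)=C_l(k).$$
   Context: $f_1,\dots,f_n$ is the standard basis of $\mathbb Z^n$. The functions $L_1,\dots,L_n$ define a $p$-invariant discrete flat connection if $L_i(k+pf_j)=L_i(k)$ and $L_i(k+f_j)L_j(k)=L_j(k+f_i)L_i(k)$ for all $1\le i,j\le n$ and $k\in\mathbb Z^n$. -}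

module Defs where

open import Level using (Level; _⊔_; suc)
open import Algebra.Apartness.Bundles using (HeytingField; HeytingCommutativeRing)
open import Algebra.Bundles using (Group; CommutativeRing)
open import Algebra.Definitions.RawMonoid using (_×_)
open import Algebra.Module.Bundles using (Module)
open import Algebra.Module.Morphism.Structures using (IsModuleHomomorphism; IsModuleIsomorphism)
import Algebra.Module.Morphism.Construct.Composition as Composition
import Algebra.Module.Morphism.Construct.Identity as Identity
open import Data.Fin.Base using (Fin)
open import Data.Integer.Base as ℤ using (ℤ; +_; 0ℤ; 1ℤ)
open import Data.Nat.Base as ℕ using (ℕ)
open import Data.Nat.Divisibility using (_∣_)
open import Data.Product.Base using (_,_; proj₁; proj₂)
open import Data.Vec.Base using (Vec; map; replicate; zipWith; _[_]≔_)
open import Function.Base using (id; _∘_)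
open import Function.Bundles using (_⇔_)

private
  variable
    c ℓ₁ ℓ₂ v ℓv : Level
    n : ℕ

fieldRing : HeytingField c ℓ₁ ℓ₂ → CommutativeRing c ℓ₁
fieldRing K = HeytingCommutativeRing.commutativeRing (HeytingField.heytingCommutativeRing K)

HasCharacteristic : HeytingField c ℓ₁ ℓ₂ → ℕ → Set ℓ₁
HasCharacteristic K p = ∀ r → (_×_ +-rawMonoid r 1# ≈ 0#) ⇔ (p ∣ r)
  where open CommutativeRing (fieldRing K)

VectorSpace : HeytingField c ℓ₁ ℓ₂ → (v ℓv : Level) → Set (c ⊔ ℓ₁ ⊔ suc (v ⊔ ℓv))
VectorSpace K v ℓv = Module (fieldRing K) v ℓv

module _ (K : HeytingField c ℓ₁ ℓ₂) (V : VectorSpace K v ℓv) where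

  open Module V

  record LinearAutomorphism : Set (c ⊔ v ⊔ ℓv) where
    field
      ⟦_⟧                 : Carrierᴹ → Carrierᴹ
      isModuleIsomorphism : IsModuleIsomorphism rawModule rawModule ⟦_⟧

    open IsModuleIsomorphism isModuleIsomorphism public

  open LinearAutomorphism using (⟦_⟧)

  private
    compose : LinearAutomorphism → LinearAutomorphism → LinearAutomorphism
    compose A B = record
      { ⟦_⟧                 = ⟦ A ⟧ ∘ ⟦ B ⟧
      ; isModuleIsomorphism = Composition.isModuleIsomorphism ≈ᴹ-trans
          (LinearAutomorphism.isModuleIsomorphism B)
          (LinearAutomorphism.isModuleIsomorphism A)
      }

    identity : LinearAutomorphism
    identity = record
      { ⟦_⟧                 = id
      ; isModuleIsomorphism = Identity.isModuleIsomorphism rawModule ≈ᴹ-refl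
      }

    module Inverse (A : LinearAutomorphism) where
      open LinearAutomorphism A hiding (⟦_⟧)

      inv : Carrierᴹ → Carrierᴹ
      inv y = proj₁ (surjective y)

      rightInverse : ∀ y → ⟦ A ⟧ (inv y) ≈ᴹ y
      rightInverse y = proj₂ (surjective y) ≈ᴹ-refl

      leftInverse : ∀ x → inv (⟦ A ⟧ x) ≈ᴹ x
      leftInverse x = injective (rightInverse (⟦ A ⟧ x))

      solve : ∀ {x y} → ⟦ A ⟧ x ≈ᴹ y → inv y ≈ᴹ x
      solve Ax≈y = injective (≈ᴹ-trans (rightInverse _) (≈ᴹ-sym Ax≈y))

      inv-cong : ∀ {x y} → x ≈ᴹ y → inv x ≈ᴹ inv y
      inv-cong x≈y = solve (≈ᴹ-trans (rightInverse _) (≈ᴹ-sym x≈y))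

      inv-isHomomorphism : IsModuleHomomorphism rawModule rawModule inv
      inv-isHomomorphism = record
        { isBimoduleHomomorphism = record
          { +ᴹ-isGroupHomomorphism = record
            { isMonoidHomomorphism = record
              { isMagmaHomomorphism = record
                { isRelHomomorphism = record { cong = inv-cong }
                ; homo = λ x y → solve (≈ᴹ-trans (+ᴹ-homo (inv x) (inv y))
                    (+ᴹ-cong (rightInverse x) (rightInverse y)))
                }
              ; ε-homo = solve 0ᴹ-homo
              }
            ; ⁻¹-homo = λ x → solve (≈ᴹ-trans (-ᴹ-homo (inv x)) (-ᴹ‿cong (rightInverse x)))
            }
          ; *ₗ-homo = λ r x → solve (≈ᴹ-trans (*ₗ-homo r (inv x))
              (*ₗ-cong (CommutativeRing.refl (fieldRing K)) (rightInverse x)))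
          ; *ᵣ-homo = λ r x → solve (≈ᴹ-trans (*ᵣ-homo r (inv x))
              (*ᵣ-cong (rightInverse x) (CommutativeRing.refl (fieldRing K))))
          }
        }

      inverse : LinearAutomorphism
      inverse = record
        { ⟦_⟧ = inv
        ; isModuleIsomorphism = record
          { isModuleMonomorphism = record
            { isModuleHomomorphism = inv-isHomomorphism
            ; injective = λ {x} {y} eq →
                ≈ᴹ-trans (≈ᴹ-sym (rightInverse x)) (≈ᴹ-trans (⟦⟧-cong eq) (rightInverse y))
            }
          ; surjective = λ x → ⟦ A ⟧ x , λ z≈Ax → solve (≈ᴹ-sym z≈Ax)
          }
        }

  GL : Group (c ⊔ v ⊔ ℓv) (v ⊔ ℓv)
  GL = record
    { Carrier = LinearAutomorphism
    ; _≈_     = λ A B → ∀ x → ⟦ A ⟧ x ≈ᴹ ⟦ B ⟧ x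
    ; _∙_     = compose
    ; ε       = identity
    ; _⁻¹     = Inverse.inverse
    ; isGroup = record
      { isMonoid = record
        { isSemigroup = record
          { isMagma = record
            { isEquivalence = record
              { refl  = λ x → ≈ᴹ-refl
              ; sym   = λ A≈B x → ≈ᴹ-sym (A≈B x)
              ; trans = λ A≈B B≈C x → ≈ᴹ-trans (A≈B x) (B≈C x)
              }
            ; ∙-cong = λ {A} {_} {_} {D} A≈B C≈D x →
                ≈ᴹ-trans (LinearAutomorphism.⟦⟧-cong A (C≈D x)) (A≈B (⟦ D ⟧ x))
            }
          ; assoc = λ A B C x → ≈ᴹ-refl
          }
        ; identity = (λ A x → ≈ᴹ-refl) , (λ A x → ≈ᴹ-refl)
        }
      ; inverse = Inverse.leftInverse , Inverse.rightInverse
      ; ⁻¹-cong = λ {A} {B} A≈B x → Inverse.solve A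
          (≈ᴹ-trans (A≈B (Inverse.inv B x)) (Inverse.rightInverse B x))
      }
    }

infixl 6 _⊕_
infixr 7 _·_

_⊕_ : Vec ℤ n → Vec ℤ n → Vec ℤ n
_⊕_ = zipWith ℤ._+_

_·_ : ℤ → Vec ℤ n → Vec ℤ n
a · k = map (a ℤ.*_) k

f : Fin n → Vec ℤ n
f {n} i = replicate n 0ℤ [ i ]≔ 1ℤ

module _ (K : HeytingField c ℓ₁ ℓ₂) (V : VectorSpace K v ℓv) where

  open Group (GL K V)

  -- L i k is the isomorphism from the fibre V over k to the fibre over k ⊕ f i of
  -- the trivial bundle ℤⁿ × V → ℤⁿ; A ∙ B applies B first.
  record IsInvariantFlatConnection (p : ℕ) (L : Fin n → Vec ℤ n → Carrier)
                                   : Set (v ⊔ ℓv) where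
    field
      invariant : ∀ i j k → L i (k ⊕ + p · f j) ≈ L i k
      flat      : ∀ i j k → L i (k ⊕ f j) ∙ L j k ≈ L j (k ⊕ f i) ∙ L i k

  -- transport L l k s = L_l(k + (s-1) f_l) ⋯ L_l(k + f_l) L_l(k), so that later
  -- steps multiply on the left; the empty product is the identity.
  transport : (Fin n → Vec ℤ n → Carrier) → Fin n → Vec ℤ n → ℕ → Carrier
  transport L l k ℕ.zero    = ε
  transport L l k (ℕ.suc s) = L l (k ⊕ + s · f l) ∙ transport L l k s

  pCurvature : ℕ → (Fin n → Vec ℤ n → Carrier) → Fin n → Vec ℤ n → Carrier
  pCurvature p L l k = transport L l k p

{-# OPTIONS --safe #-}

-- Call B : ℤⁿ → GL(V) parallel with shift w if L_l(k+w) B(k) = B(k+f_l) L_l(k) for all k.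
-- Stacking s of these squares along f_l gives the same relation for the transport over s
-- steps. Flatness says that L_m is parallel with shift f_m, and invariance that the
-- identity is parallel with shift p f_m; this yields the first and third equations.
-- Together they say that C_m is parallel with shift p f_m, which yields the second.

module Submission where

open import Defs
open import Level using (Level)
open import Algebra.Apartness.Bundles using (HeytingField)
open import Algebra.Bundles using (Group)
open import Algebra.Module.Bundles using (Module)
open import Data.Fin.Base using (Fin)
open import Data.Integer.Base using (ℤ; +_; 0ℤ; _+_)
open import Data.Integer.Properties using (+-assoc; +-comm; +-identityʳ; *-zeroˡ; suc-*)
open import Data.Nat.Base using (ℕ; zero; suc; _<_)
open import Data.Product.Base using (_×_; _,_)
open import Data.Vec.Base using (Vec; []; _∷_)
open import Data.Vec.Properties using (zipWith-assoc; zipWith-comm)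
open import Relation.Binary.PropositionalEquality
  using (_≡_; refl; sym; trans; cong; cong₂; subst; subst₂)

private
  variable
    c ℓ₁ ℓ₂ v ℓv : Level
    n : ℕ

⊕-zero-· : (k w : Vec ℤ n) → k ⊕ 0ℤ · w ≡ k
⊕-zero-· []      []      = refl
⊕-zero-· (a ∷ k) (b ∷ w) =
  cong₂ _∷_ (trans (cong (_+_ a) (*-zeroˡ b)) (+-identityʳ a)) (⊕-zero-· k w)

suc-· : ∀ s (w : Vec ℤ n) → + suc s · w ≡ + s · w ⊕ w
suc-· s []      = refl
suc-· s (b ∷ w) = cong₂ _∷_ (trans (suc-* (+ s) b) (+-comm b _)) (suc-· s w)

⊕-suc-· : ∀ s (k w : Vec ℤ n) → k ⊕ + s · w ⊕ w ≡ k ⊕ + suc s · w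
⊕-suc-· s k w = trans (zipWith-assoc +-assoc k (+ s · w) w) (cong (k ⊕_) (sym (suc-· s w)))

⊕-swap : (k w u : Vec ℤ n) → k ⊕ w ⊕ u ≡ k ⊕ u ⊕ w
⊕-swap k w u = trans (zipWith-assoc +-assoc k w u)
  (trans (cong (k ⊕_) (zipWith-comm +-comm w u)) (sym (zipWith-assoc +-assoc k u w)))

module _ (K : HeytingField c ℓ₁ ℓ₂) (V : VectorSpace K v ℓv) where

  open Group (GL K V) using (Carrier; _≈_; _∙_; ε)
  open Module V using (Carrierᴹ; ≈ᴹ-refl; ≈ᴹ-sym; ≈ᴹ-trans) renaming (_≈ᴹ_ to _≋_)
  open LinearAutomorphism using (⟦_⟧; ⟦⟧-cong)

  transport-parallel : (L : Fin n → Vec ℤ n → Carrier) (B : Vec ℤ n → Carrier)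
    (l : Fin n) (w : Vec ℤ n) →
    (∀ k → L l (k ⊕ w) ∙ B k ≈ B (k ⊕ f l) ∙ L l k) →
    ∀ k s → transport K V L l (k ⊕ w) s ∙ B k ≈ B (k ⊕ + s · f l) ∙ transport K V L l k s
  transport-parallel L B l w parallel k zero x =
    subst (λ j → ⟦ B k ⟧ x ≋ ⟦ B j ⟧ x) (sym (⊕-zero-· k (f l))) ≈ᴹ-refl
  transport-parallel L B l w parallel k (suc s) x = ≈ᴹ-trans
    (⟦⟧-cong (L l (k ⊕ w ⊕ + s · f l)) (transport-parallel L B l w parallel k s x))
    (subst₂ (λ i j → ⟦ L l i ⟧ (⟦ B (k ⊕ + s · f l) ⟧ y) ≋ ⟦ B j ⟧ (⟦ L l (k ⊕ + s · f l) ⟧ y))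
      (⊕-swap k (+ s · f l) w) (⊕-suc-· s k (f l)) (parallel (k ⊕ + s · f l) y))
    where
    y : Carrierᴹ
    y = ⟦ transport K V L l k s ⟧ x

  module _ (p : ℕ) (L : Fin n → Vec ℤ n → Carrier)
           (connection : IsInvariantFlatConnection K V p L) where

    open IsInvariantFlatConnection connection

    private
      C : Fin n → Vec ℤ n → Carrier
      C = pCurvature K V p L

    pCurvature-parallel : ∀ l m k → C l (k ⊕ f m) ∙ L m k ≈ L m k ∙ C l k
    pCurvature-parallel l m k x = ≈ᴹ-trans
      (transport-parallel L (L m) l (f m) (flat l m) k p x)
      (invariant m l k (⟦ C l k ⟧ x))

    pCurvature-invariant : ∀ l m k → C l (k ⊕ + p · f m) ≈ C l k
    pCurvature-invariant l m k =
      transport-parallel L (λ _ → ε) l (+ p · f m) (invariant l m) k p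

    pCurvature-commute : ∀ l m k → C l k ∙ C m k ≈ C m k ∙ C l k
    pCurvature-commute l m k x = ≈ᴹ-trans
      (≈ᴹ-sym (pCurvature-invariant l m k (⟦ C m k ⟧ x)))
      (≈ᴹ-trans
        (transport-parallel L (C m) l (+ p · f m) parallel k p x)
        (pCurvature-invariant m l k (⟦ C l k ⟧ x)))
      where
      parallel : ∀ j → L l (j ⊕ + p · f m) ∙ C m j ≈ C m (j ⊕ f l) ∙ L l j
      parallel j y = ≈ᴹ-trans (invariant l m j (⟦ C m j ⟧ y))
        (≈ᴹ-sym (pCurvature-parallel m l j y))

lemma2p1 : ∀ {c ℓ₁ ℓ₂ v ℓv : Level} (K : HeytingField c ℓ₁ ℓ₂) (p : ℕ) →
    HasCharacteristic K p → 2 < p →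
    (V : VectorSpace K v ℓv) (n : ℕ) →
    let open Group (GL K V) in
    (L : Fin n → Vec ℤ n → Carrier) →
    IsInvariantFlatConnection K V p L →
    let C = pCurvature K V p L in
    (l m : Fin n) (k : Vec ℤ n) →
    (C l (k ⊕ f m) ∙ L m k ≈ L m k ∙ C l k)
    × (C l k ∙ C m k ≈ C m k ∙ C l k)
    × (C l (k ⊕ + p · f m) ≈ C l k)
lemma2p1 K p _ _ V n L connection l m k =
  pCurvature-parallel K V p L connection l m k ,
  pCurvature-commute K V p L connection l m k ,
  pCurvature-invariant K V p L connection l m k
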